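{- Let $G_1$ and $G_2$ be torsion-free nilpotent groups, and for $i=1,2$ let $S_i$ be a finite symmetric generating set of $G_i$. Then every graph isomorphism from $\mathrm{Cay}(G_1;S_1)$ to $\mathrm{Cay}(G_2;S_2)$ is an affine bijection.
   Context: For a group $G$ and a symmetric subset $S$ ($S=S^{ -1}$), $\mathrm{Cay}(G;S)$ is the graph with vertex set $G$ in which $g$ is adjacent to $gs$ for all $g\in G$, $s\in S$. A map $\varphi\colon G_1\to G_2$ between groups is an affine bijection if there exist a group isomorphism $\alpha\colon G_1\to G_2$ and $h\in G_2$ such that $\varphi(x)=h\,\alpha(x)$ for all $x\in G_1$. -}

module Defs where

open import Level using (Level; _⊔_; Lift)
open import Data.Nat using (ℕ; zero; suc)
open import Data.Unit.Polymorphic using (⊤)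
open import Data.Product using (Σ; ∃; ∃-syntax; _×_; _,_)
open import Data.List using (List)
open import Data.List.Relation.Unary.Any using (Any)
open import Function.Bundles using (Bijection)
open import Algebra.Bundles using (Group)
open import Algebra.Morphism.Structures using (module GroupMorphisms)

private variable c ℓ c₁ ℓ₁ c₂ ℓ₂ : Level

module GroupNotions (G : Group c ℓ) where
  open Group G

  infixr 8 _^_
  _^_ : Carrier → ℕ → Carrier
  x ^ zero  = ε
  x ^ suc n = x ∙ (x ^ n)

  TorsionFree : Set (c ⊔ ℓ)
  TorsionFree = ∀ (x : Carrier) (n : ℕ) → x ^ suc n ≈ ε → x ≈ ε

  ⁅_,_⁆ : Carrier → Carrier → Carrier
  ⁅ x , y ⁆ = ((x ⁻¹ ∙ y ⁻¹) ∙ x) ∙ y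

  data ⟨_⟩ (P : Carrier → Set (c ⊔ ℓ)) : Carrier → Set (c ⊔ ℓ) where
    gen  : ∀ {x} → P x → ⟨ P ⟩ x
    unit : ⟨ P ⟩ ε
    mul  : ∀ {x y} → ⟨ P ⟩ x → ⟨ P ⟩ y → ⟨ P ⟩ (x ∙ y)
    inv  : ∀ {x} → ⟨ P ⟩ x → ⟨ P ⟩ (x ⁻¹)
    resp : ∀ {x y} → x ≈ y → ⟨ P ⟩ x → ⟨ P ⟩ y

  γ : ℕ → Carrier → Set (c ⊔ ℓ)
  γ zero    = λ _ → ⊤
  γ (suc k) = ⟨ (λ z → ∃[ x ] ∃[ y ] (γ k x × z ≈ ⁅ x , y ⁆)) ⟩

  Nilpotent : Set (c ⊔ ℓ)
  Nilpotent = ∃[ k ] (∀ x → γ k x → x ≈ ε)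

  -- a finite subset given as a list; membership up to ≈
  _∈S_ : Carrier → List Carrier → Set (c ⊔ ℓ)
  x ∈S S = Any (x ≈_) S

  Symmetric : List Carrier → Set (c ⊔ ℓ)
  Symmetric S = ∀ {s} → s ∈S S → (s ⁻¹) ∈S S

  Generates : List Carrier → Set (c ⊔ ℓ)
  Generates S = ∀ x → ⟨ (λ y → y ∈S S) ⟩ x

  CayAdj : List Carrier → Carrier → Carrier → Set (c ⊔ ℓ)
  CayAdj S g h = ∃[ s ] (s ∈S S × h ≈ g ∙ s)

open GroupNotions public

record CayleyIso (G₁ : Group c₁ ℓ₁) (G₂ : Group c₂ ℓ₂)
                 (S₁ : List (Group.Carrier G₁)) (S₂ : List (Group.Carrier G₂))
                 : Set (c₁ ⊔ ℓ₁ ⊔ c₂ ⊔ ℓ₂) where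
  field
    bij      : Bijection (Group.setoid G₁) (Group.setoid G₂)
  open Bijection bij public using (to)
  field
    preserve : ∀ g h → CayAdj G₁ S₁ g h → CayAdj G₂ S₂ (to g) (to h)
    reflect  : ∀ g h → CayAdj G₂ S₂ (to g) (to h) → CayAdj G₁ S₁ g h

AffineBijection : (G₁ : Group c₁ ℓ₁) (G₂ : Group c₂ ℓ₂)
                → (Group.Carrier G₁ → Group.Carrier G₂) → Set (c₁ ⊔ ℓ₁ ⊔ c₂ ⊔ ℓ₂)
AffineBijection G₁ G₂ φ =
  Σ (Group.Carrier G₁ → Group.Carrier G₂) λ α →
    GroupMorphisms.IsGroupIsomorphism (Group.rawGroup G₁) (Group.rawGroup G₂) α ×
    ∃[ h ] (∀ x → Group._≈_ G₂ (φ x) (Group._∙_ G₂ h (α x)))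

{-# OPTIONS --safe #-}
module Submission where

-- Let φ be an isomorphism of the Cayley graphs and let z be central in G₁.  The map
-- f x = φ(x)⁻¹ φ(x z) has finite image, since x and x z are at bounded distance.  Modulo
-- each term of a central series of G₂ with torsion-free quotients, f is harmonic: its
-- changes along the edges at x average out over the orbits of the permutation of S₂
-- that relates the edges at φ(x) to those at φ(x z).  By the maximum principle (in the
-- form of an extreme point of a finite set in a torsion-free abelian group), f is
-- constant, and a pigeonhole argument shows that its value is central.  Hence φ descends to
-- G₁/Z(G₁) → G₂/Z(G₂), where it is affine by induction on the class.  Upstairs,
-- φ(x)⁻¹ φ(x s) can then vary with x only by central factors that translate a finite
-- set of generators into itself, and these are trivial because G₂ is torsion-free.
--
-- Equality in the groups is not assumed decidable.  The argument is classical, so it is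
-- carried out for groups whose equality is stable under double negation relative to a
-- type A in place of ⊥; since the conclusion is an equation, taking A to be that
-- equation recovers the constructive statement (Friedman's A-translation).

open import Defs
open import Level using (Level; _⊔_)
open import Algebra.Bundles using (Group)
open import Algebra.Morphism.Structures using (module GroupMorphisms)
import Algebra.Properties.Group as GroupProperties
open import Data.Bool using (Bool; true; false; not)
open import Data.Fin using (Fin)
import Data.Fin.Properties as Fin
open import Data.List using (List; []; _∷_; _++_; [_]; foldr; foldl; length; replicate; map;
  cartesianProduct; cartesianProductWith)
open import Data.List.Membership.Propositional using (find) renaming (_∈_ to _∈ˡ_)
open import Data.List.Properties using (length-++; length-map; length-replicate; map-++)
open import Data.List.Relation.Unary.All as All using (All; []; _∷_)
import Data.List.Relation.Unary.All.Properties as All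
open import Data.List.Relation.Unary.Any as Any using (Any; here; there)
import Data.List.Relation.Unary.Any.Properties as Any
open import Data.Nat using (ℕ; zero; suc; _+_; _*_)
open import Data.Nat.Properties using (+-assoc; +-identityʳ; +-suc)
open import Data.Product using (_×_; _,_; ∃-syntax; proj₁; proj₂)
open import Data.Sum using (_⊎_; inj₁; inj₂)
open import Data.Unit.Polymorphic using (⊤; tt)
open import Data.Vec using (Vec; lookup)
open import Function.Bundles using (Bijection)
import Relation.Binary.Reasoning.Setoid as SetoidReasoning
open import Relation.Binary.PropositionalEquality as ≡ using (_≡_)
import Relation.Binary.Reflection as Reflection
open import Relation.Nullary using (yes; no)

private variable c ℓ c₁ ℓ₁ c₂ ℓ₂ : Level

-- Group identities by free reduction of words

module FreeGroupSolver (G : Group c ℓ) where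
  open Group G
  open GroupProperties G using (⁻¹-anti-homo-∙; ⁻¹-involutive; ε⁻¹≈ε)
  open SetoidReasoning setoid

  infixl 7 _⊙_
  infix  8 _⁻

  data Expr (n : ℕ) : Set where
    var : Fin n → Expr n
    _⊙_ : Expr n → Expr n → Expr n
    _⁻  : Expr n → Expr n
    one : Expr n

  Word : ℕ → Set
  Word n = List (Bool × Fin n)

  push : ∀ {n} → Bool → Fin n → Word n → Word n
  push b i [] = (b , i) ∷ []
  push true  i ((true  , j) ∷ w) = (true  , i) ∷ (true  , j) ∷ w
  push false i ((false , j) ∷ w) = (false , i) ∷ (false , j) ∷ w
  push true  i ((false , j) ∷ w) with i Fin.≟ j
  ... | yes _ = w
  ... | no  _ = (true , i) ∷ (false , j) ∷ w
  push false i ((true , j) ∷ w) with i Fin.≟ j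
  ... | yes _ = w
  ... | no  _ = (false , i) ∷ (true , j) ∷ w

  -- reduce b e w is the reduced word of e^{±1} w, where b is the sign.
  reduce : ∀ {n} → Bool → Expr n → Word n → Word n
  reduce b     (var i) w = push b i w
  reduce true  (e ⊙ f) w = reduce true e (reduce true f w)
  reduce false (e ⊙ f) w = reduce false f (reduce false e w)
  reduce b     (e ⁻)   w = reduce (not b) e w
  reduce b     one     w = w

  ⟦_⟧ : ∀ {n} → Expr n → Vec Carrier n → Carrier
  ⟦ var i ⟧ ρ = lookup ρ i
  ⟦ e ⊙ f ⟧ ρ = ⟦ e ⟧ ρ ∙ ⟦ f ⟧ ρ
  ⟦ e ⁻ ⟧   ρ = ⟦ e ⟧ ρ ⁻¹
  ⟦ one ⟧   ρ = ε

  signed : Bool → Carrier → Carrier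
  signed true  x = x
  signed false x = x ⁻¹

  ⟦_⟧ʷ : ∀ {n} → Word n → Vec Carrier n → Carrier
  ⟦ [] ⟧ʷ          ρ = ε
  ⟦ (b , i) ∷ w ⟧ʷ ρ = signed b (lookup ρ i) ∙ ⟦ w ⟧ʷ ρ

  push-correct : ∀ {n} b (i : Fin n) w ρ →
                 ⟦ push b i w ⟧ʷ ρ ≈ signed b (lookup ρ i) ∙ ⟦ w ⟧ʷ ρ
  push-correct b     i []                ρ = refl
  push-correct true  i ((true  , j) ∷ w) ρ = refl
  push-correct false i ((false , j) ∷ w) ρ = refl
  push-correct true  i ((false , j) ∷ w) ρ with i Fin.≟ j
  ... | no  _      = refl
  ... | yes ≡.refl = begin
    ⟦ w ⟧ʷ ρ                              ≈⟨ identityˡ _ ⟨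
    ε ∙ ⟦ w ⟧ʷ ρ                          ≈⟨ ∙-congʳ (inverseʳ _) ⟨
    lookup ρ i ∙ lookup ρ i ⁻¹ ∙ ⟦ w ⟧ʷ ρ ≈⟨ assoc _ _ _ ⟩
    lookup ρ i ∙ (lookup ρ i ⁻¹ ∙ ⟦ w ⟧ʷ ρ) ∎
  push-correct false i ((true , j) ∷ w)  ρ with i Fin.≟ j
  ... | no  _      = refl
  ... | yes ≡.refl = begin
    ⟦ w ⟧ʷ ρ                              ≈⟨ identityˡ _ ⟨
    ε ∙ ⟦ w ⟧ʷ ρ                          ≈⟨ ∙-congʳ (inverseˡ _) ⟨
    lookup ρ i ⁻¹ ∙ lookup ρ i ∙ ⟦ w ⟧ʷ ρ ≈⟨ assoc _ _ _ ⟩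
    lookup ρ i ⁻¹ ∙ (lookup ρ i ∙ ⟦ w ⟧ʷ ρ) ∎

  signed-not : ∀ b x → signed (not b) x ≈ signed b (x ⁻¹)
  signed-not true  x = refl
  signed-not false x = sym (⁻¹-involutive x)

  signed-ε : ∀ b → signed b ε ≈ ε
  signed-ε true  = refl
  signed-ε false = ε⁻¹≈ε

  reduce-correct : ∀ {n} b (e : Expr n) w ρ →
                   ⟦ reduce b e w ⟧ʷ ρ ≈ signed b (⟦ e ⟧ ρ) ∙ ⟦ w ⟧ʷ ρ
  reduce-correct b     (var i) w ρ = push-correct b i w ρ
  reduce-correct true  (e ⊙ f) w ρ = begin
    ⟦ reduce true e (reduce true f w) ⟧ʷ ρ ≈⟨ reduce-correct true e _ ρ ⟩
    ⟦ e ⟧ ρ ∙ ⟦ reduce true f w ⟧ʷ ρ       ≈⟨ ∙-congˡ (reduce-correct true f w ρ) ⟩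
    ⟦ e ⟧ ρ ∙ (⟦ f ⟧ ρ ∙ ⟦ w ⟧ʷ ρ)         ≈⟨ assoc _ _ _ ⟨
    ⟦ e ⊙ f ⟧ ρ ∙ ⟦ w ⟧ʷ ρ                 ∎
  reduce-correct false (e ⊙ f) w ρ = begin
    ⟦ reduce false f (reduce false e w) ⟧ʷ ρ   ≈⟨ reduce-correct false f _ ρ ⟩
    ⟦ f ⟧ ρ ⁻¹ ∙ ⟦ reduce false e w ⟧ʷ ρ       ≈⟨ ∙-congˡ (reduce-correct false e w ρ) ⟩
    ⟦ f ⟧ ρ ⁻¹ ∙ (⟦ e ⟧ ρ ⁻¹ ∙ ⟦ w ⟧ʷ ρ)       ≈⟨ assoc _ _ _ ⟨
    ⟦ f ⟧ ρ ⁻¹ ∙ ⟦ e ⟧ ρ ⁻¹ ∙ ⟦ w ⟧ʷ ρ         ≈⟨ ∙-congʳ (⁻¹-anti-homo-∙ _ _) ⟨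
    ⟦ e ⊙ f ⟧ ρ ⁻¹ ∙ ⟦ w ⟧ʷ ρ                  ∎
  reduce-correct b     (e ⁻)   w ρ =
    trans (reduce-correct (not b) e w ρ) (∙-congʳ (signed-not b _))
  reduce-correct true  one     w ρ = sym (identityˡ _)
  reduce-correct false one     w ρ = sym (trans (∙-congʳ ε⁻¹≈ε) (identityˡ _))

  open Reflection setoid var ⟦_⟧ (λ e → ⟦ reduce true e [] ⟧ʷ)
    (λ e ρ → trans (reduce-correct true e [] ρ) (identityʳ _)) public
    using (solve; _⊜_)

-- Mentions only the commutator operation, which a group shares with its quotients.
LeftNormed : {C : Set c} → (C → C → C) → ℕ → C → Set c
LeftNormed comm zero    w = ⊤
LeftNormed comm (suc k) w = ∃[ u ] ∃[ y ] LeftNormed comm k u × w ≡ comm u y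

-- Powers, commutators and the quotient by the center

module GroupTheory (G : Group c ℓ) where
  open Group G
  open GroupProperties G
  open FreeGroupSolver G using (solve; _⊜_; _⊙_; _⁻; one)
  open SetoidReasoning setoid

  ∏ : List Carrier → Carrier
  ∏ = foldr _∙_ ε

  -- Unlike the recursive power of Defs, this only mentions the raw operations,
  -- so it is the same function in G and in its quotients below.
  infixr 8 _↑_
  _↑_ : Carrier → ℕ → Carrier
  x ↑ n = ∏ (replicate n x)

  ∏-++ : ∀ xs ys → ∏ (xs ++ ys) ≈ ∏ xs ∙ ∏ ys
  ∏-++ []       ys = sym (identityˡ _)
  ∏-++ (x ∷ xs) ys = trans (∙-congˡ (∏-++ xs ys)) (sym (assoc _ _ _))

  ∏-const : ∀ {x xs} → All (_≈ x) xs → ∏ xs ≈ x ↑ length xs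
  ∏-const []       = refl
  ∏-const (e ∷ es) = ∙-cong e (∏-const es)

  ↑-cong : ∀ n {x y} → x ≈ y → x ↑ n ≈ y ↑ n
  ↑-cong zero    x≈y = refl
  ↑-cong (suc n) x≈y = ∙-cong x≈y (↑-cong n x≈y)

  ↑-ε : ∀ n → ε ↑ n ≈ ε
  ↑-ε zero    = refl
  ↑-ε (suc n) = trans (identityˡ _) (↑-ε n)

  ↑-+ : ∀ x m n → x ↑ (m + n) ≈ x ↑ m ∙ x ↑ n
  ↑-+ x zero    n = sym (identityˡ _)
  ↑-+ x (suc m) n = trans (∙-congˡ (↑-+ x m n)) (sym (assoc _ _ _))

  Commute : Carrier → Carrier → Set ℓ
  Commute x y = x ∙ y ≈ y ∙ x

  ε-commute : ∀ x → Commute ε x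
  ε-commute x = trans (identityˡ x) (sym (identityʳ x))

  ∙-commute : ∀ {x y z} → Commute x z → Commute y z → Commute (x ∙ y) z
  ∙-commute {x} {y} {z} xz yz = begin
    x ∙ y ∙ z   ≈⟨ assoc _ _ _ ⟩
    x ∙ (y ∙ z) ≈⟨ ∙-congˡ yz ⟩
    x ∙ (z ∙ y) ≈⟨ assoc _ _ _ ⟨
    x ∙ z ∙ y   ≈⟨ ∙-congʳ xz ⟩
    z ∙ x ∙ y   ≈⟨ assoc _ _ _ ⟩
    z ∙ (x ∙ y) ∎

  ⁻¹-commute : ∀ {x z} → Commute x z → Commute (x ⁻¹) z
  ⁻¹-commute {x} {z} xz = begin
    x ⁻¹ ∙ z             ≈⟨ solve 2 (λ x z → x ⁻ ⊙ z ⊜ x ⁻ ⊙ (z ⊙ x) ⊙ x ⁻) refl x z ⟩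
    x ⁻¹ ∙ (z ∙ x) ∙ x ⁻¹ ≈⟨ ∙-congʳ (∙-congˡ xz) ⟨
    x ⁻¹ ∙ (x ∙ z) ∙ x ⁻¹ ≈⟨ solve 2 (λ x z → x ⁻ ⊙ (x ⊙ z) ⊙ x ⁻ ⊜ z ⊙ x ⁻) refl x z ⟩
    z ∙ x ⁻¹             ∎

  commute-resp : ∀ {x y z} → x ≈ y → Commute x z → Commute y z
  commute-resp x≈y xz = trans (∙-congʳ (sym x≈y)) (trans xz (∙-congˡ x≈y))

  ∏-commute : ∀ {z xs} → All (λ x → Commute x z) xs → Commute (∏ xs) z
  ∏-commute []         = ε-commute _
  ∏-commute (xz ∷ xsz) = ∙-commute xz (∏-commute xsz)

  ↑-commute : ∀ n {x z} → Commute x z → Commute (x ↑ n) z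
  ↑-commute zero    xz = ε-commute _
  ↑-commute (suc n) xz = ∙-commute xz (↑-commute n xz)

  interchange : ∀ {x y z w} → Commute y z → (x ∙ y) ∙ (z ∙ w) ≈ (x ∙ z) ∙ (y ∙ w)
  interchange {x} {y} {z} {w} yz = begin
    (x ∙ y) ∙ (z ∙ w) ≈⟨ solve 4 (λ x y z w → x ⊙ y ⊙ (z ⊙ w) ⊜ x ⊙ (y ⊙ z) ⊙ w) refl x y z w ⟩
    x ∙ (y ∙ z) ∙ w   ≈⟨ ∙-congʳ (∙-congˡ yz) ⟩
    x ∙ (z ∙ y) ∙ w   ≈⟨ solve 4 (λ x y z w → x ⊙ (z ⊙ y) ⊙ w ⊜ (x ⊙ z) ⊙ (y ⊙ w)) refl x y z w ⟩
    (x ∙ z) ∙ (y ∙ w) ∎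

  ↑-distrib-∙ : ∀ n {x y} → Commute x y → (x ∙ y) ↑ n ≈ x ↑ n ∙ y ↑ n
  ↑-distrib-∙ zero    xy = sym (identityˡ _)
  ↑-distrib-∙ (suc n) xy =
    trans (∙-congˡ (↑-distrib-∙ n xy)) (interchange (sym (↑-commute n xy)))

  ↑-⁻¹ : ∀ n x → (x ⁻¹) ↑ n ≈ (x ↑ n) ⁻¹
  ↑-⁻¹ n x = inverseˡ-unique _ _ (trans
    (sym (↑-distrib-∙ n (trans (inverseˡ x) (sym (inverseʳ x)))))
    (trans (↑-cong n (inverseˡ x)) (↑-ε n)))

  ↑-* : ∀ x m n → x ↑ (m * n) ≈ (x ↑ m) ↑ n
  ↑-* x zero    n = sym (↑-ε n)
  ↑-* x (suc m) n = begin
    x ↑ (n + m * n)       ≈⟨ ↑-+ x n (m * n) ⟩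
    x ↑ n ∙ x ↑ (m * n)   ≈⟨ ∙-congˡ (↑-* x m n) ⟩
    x ↑ n ∙ (x ↑ m) ↑ n   ≈⟨ ↑-distrib-∙ n (sym (↑-commute m refl)) ⟨
    (x ∙ x ↑ m) ↑ n       ∎

  ↑-conj : ∀ n t x → (t ⁻¹ ∙ x ∙ t) ↑ n ≈ t ⁻¹ ∙ x ↑ n ∙ t
  ↑-conj zero    t x = solve 1 (λ t → one ⊜ t ⁻ ⊙ one ⊙ t) refl t
  ↑-conj (suc n) t x = trans (∙-congˡ (↑-conj n t x))
    (solve 3 (λ t x y → t ⁻ ⊙ x ⊙ t ⊙ (t ⁻ ⊙ y ⊙ t) ⊜ t ⁻ ⊙ (x ⊙ y) ⊙ t) refl t x (x ↑ n))

  Central : Carrier → Set (c ⊔ ℓ)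
  Central x = ∀ y → Commute x y

  ε-central : Central ε
  ε-central = ε-commute

  ∙-central : ∀ {x y} → Central x → Central y → Central (x ∙ y)
  ∙-central xᶜ yᶜ z = ∙-commute (xᶜ z) (yᶜ z)

  ⁻¹-central : ∀ {x} → Central x → Central (x ⁻¹)
  ⁻¹-central xᶜ z = ⁻¹-commute (xᶜ z)

  central-resp : ∀ {x y} → x ≈ y → Central x → Central y
  central-resp x≈y xᶜ z = commute-resp x≈y (xᶜ z)

  conj-central : ∀ {x} y → Central x → y ⁻¹ ∙ x ∙ y ≈ x
  conj-central {x} y xᶜ = begin
    y ⁻¹ ∙ x ∙ y   ≈⟨ assoc _ _ _ ⟩
    y ⁻¹ ∙ (x ∙ y) ≈⟨ ∙-congˡ (xᶜ y) ⟩
    y ⁻¹ ∙ (y ∙ x) ≈⟨ solve 2 (λ x y → y ⁻ ⊙ (y ⊙ x) ⊜ x) refl x y ⟩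
    x              ∎

  ⁅⁆≈ε⇒commute : ∀ {x y} → ⁅_,_⁆ G x y ≈ ε → Commute x y
  ⁅⁆≈ε⇒commute {x} {y} e = begin
    x ∙ y                   ≈⟨ solve 2 (λ x y → x ⊙ y ⊜ y ⊙ x ⊙ (x ⁻ ⊙ y ⁻ ⊙ x ⊙ y)) refl x y ⟩
    y ∙ x ∙ ⁅_,_⁆ G x y     ≈⟨ ∙-congˡ e ⟩
    y ∙ x ∙ ε               ≈⟨ identityʳ _ ⟩
    y ∙ x                   ∎

  commute⇒⁅⁆≈ε : ∀ {x y} → Commute x y → ⁅_,_⁆ G x y ≈ ε
  commute⇒⁅⁆≈ε {x} {y} xy = begin
    x ⁻¹ ∙ y ⁻¹ ∙ x ∙ y   ≈⟨ solve 2 (λ x y → x ⁻ ⊙ y ⁻ ⊙ x ⊙ y ⊜ (y ⊙ x) ⁻ ⊙ (x ⊙ y)) refl x y ⟩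
    (y ∙ x) ⁻¹ ∙ (x ∙ y)  ≈⟨ ∙-congˡ xy ⟩
    (y ∙ x) ⁻¹ ∙ (y ∙ x)  ≈⟨ inverseˡ _ ⟩
    ε                     ∎

  Torsionless : Set (c ⊔ ℓ)
  Torsionless = ∀ x n → x ↑ suc n ≈ ε → x ≈ ε

  ↑-injective : Torsionless → ∀ n {x y} → Commute x y → x ↑ suc n ≈ y ↑ suc n → x ≈ y
  ↑-injective tf n {x} {y} xy e = x∙y⁻¹≈ε⇒x≈y x y (tf _ n (begin
    (x ∙ y ⁻¹) ↑ suc n         ≈⟨ ↑-distrib-∙ (suc n) (sym (⁻¹-commute (sym xy))) ⟩
    x ↑ suc n ∙ (y ⁻¹) ↑ suc n ≈⟨ ∙-cong e (↑-⁻¹ (suc n) y) ⟩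
    y ↑ suc n ∙ (y ↑ suc n) ⁻¹ ≈⟨ inverseʳ _ ⟩
    ε                          ∎))

  Class≤ : ℕ → Set (c ⊔ ℓ)
  Class≤ k = ∀ w → LeftNormed (⁅_,_⁆ G) k w → w ≈ ε

  -- This is what makes the quotient by the center torsion-free again: a torsion element there is
  -- one with a central power.
  ↑-central⇒central : Torsionless → ∀ {k} → Class≤ k →
                      ∀ x n → Central (x ↑ suc n) → Central x
  ↑-central⇒central tf {k} nil x n xⁿᶜ y =
    sym (commutes k 0 (+-identityʳ k) y tt)
    where
    -- Descends to shorter commutators w: ⁅ w , x ⁆ commutes with x already, so
    -- ⁅ w , x ⁆ ↑ suc n ≈ ⁅ w , x ↑ suc n ⁆ ≈ ε.
    commutes : ∀ j i → j + i ≡ k → ∀ w → LeftNormed (⁅_,_⁆ G) i w → Commute w x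
    commutes zero    i ≡.refl w wᵢ = commute-resp (sym (nil w wᵢ)) (ε-commute x)
    commutes (suc j) i eq     w wᵢ = ⁅⁆≈ε⇒commute (tf u n (begin
        (v ∙ x) ↑ suc n                   ≈⟨ ↑-distrib-∙ (suc n) vx ⟩
        v ↑ suc n ∙ x ↑ suc n             ≈⟨ ∙-congʳ (↑-conj (suc n) w (x ⁻¹)) ⟩
        w ⁻¹ ∙ (x ⁻¹) ↑ suc n ∙ w ∙ x ↑ suc n
          ≈⟨ ∙-congʳ (∙-congʳ (∙-congˡ (↑-⁻¹ (suc n) x))) ⟩
        ⁅_,_⁆ G w (x ↑ suc n)             ≈⟨ commute⇒⁅⁆≈ε (sym (xⁿᶜ w)) ⟩
        ε                                 ∎))
      where
      v = w ⁻¹ ∙ x ⁻¹ ∙ w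
      u = ⁅_,_⁆ G w x
      ux : Commute u x
      ux = commutes j (suc i) (≡.trans (+-suc j i) eq) u (w , x , wᵢ , ≡.refl)
      vx : Commute v x
      vx = commute-resp (solve 2 (λ v x → v ⊙ x ⊙ x ⁻ ⊜ v) refl v x)
             (∙-commute ux (⁻¹-commute refl))

  -- The quotient by the center: the same carrier with a coarser equality.
  infix 4 _≈ᶻ_
  _≈ᶻ_ : Carrier → Carrier → Set (c ⊔ ℓ)
  x ≈ᶻ y = Central (x ⁻¹ ∙ y)

  ≈⇒≈ᶻ : ∀ {x y} → x ≈ y → x ≈ᶻ y
  ≈⇒≈ᶻ {x} x≈y = central-resp (trans (sym (inverseˡ x)) (∙-congˡ x≈y)) ε-central

  central⇒≈ᶻ : ∀ {x z} → Central z → x ≈ᶻ x ∙ z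
  central⇒≈ᶻ {x} {z} = central-resp (solve 2 (λ x z → z ⊜ x ⁻ ⊙ (x ⊙ z)) refl x z)

  central⇒≈ᶻε : ∀ {x} → Central x → x ≈ᶻ ε
  central⇒≈ᶻε xᶜ = central-resp (sym (identityʳ _)) (⁻¹-central xᶜ)

  ≈ᶻε⇒central : ∀ {x} → x ≈ᶻ ε → Central x
  ≈ᶻε⇒central {x} e =
    central-resp (solve 1 (λ x → (x ⁻ ⊙ one) ⁻ ⊜ x) refl x) (⁻¹-central e)

  G/Z : Group c (c ⊔ ℓ)
  G/Z = record
    { Carrier = Carrier
    ; _≈_ = _≈ᶻ_
    ; _∙_ = _∙_
    ; ε = ε
    ; _⁻¹ = _⁻¹
    ; isGroup = record
      { isMonoid = record
        { isSemigroup = record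
          { isMagma = record
            { isEquivalence = record
              { refl = ≈⇒≈ᶻ refl
              ; sym = λ {x} {y} e → central-resp
                  (solve 2 (λ x y → (x ⁻ ⊙ y) ⁻ ⊜ y ⁻ ⊙ x) refl x y) (⁻¹-central e)
              ; trans = λ {x} {y} {z} e f → central-resp
                  (solve 3 (λ x y z → x ⁻ ⊙ y ⊙ (y ⁻ ⊙ z) ⊜ x ⁻ ⊙ z) refl x y z)
                  (∙-central e f)
              }
            ; ∙-cong = λ {x} {y} {u} {v} e f → central-resp
                (begin
                  (x ⁻¹ ∙ y) ∙ (u ⁻¹ ∙ v)  ≈⟨ assoc _ _ _ ⟨
                  (x ⁻¹ ∙ y) ∙ u ⁻¹ ∙ v    ≈⟨ ∙-congʳ (e (u ⁻¹)) ⟩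
                  u ⁻¹ ∙ (x ⁻¹ ∙ y) ∙ v
                    ≈⟨ solve 4 (λ x y u v → u ⁻ ⊙ (x ⁻ ⊙ y) ⊙ v ⊜ (x ⊙ u) ⁻ ⊙ (y ⊙ v)) refl x y u v ⟩
                  (x ∙ u) ⁻¹ ∙ (y ∙ v)     ∎)
                (∙-central e f)
            }
          ; assoc = λ x y z → ≈⇒≈ᶻ (assoc x y z)
          }
        ; identity = (λ x → ≈⇒≈ᶻ (identityˡ x)) , (λ x → ≈⇒≈ᶻ (identityʳ x))
        }
      ; inverse = (λ x → ≈⇒≈ᶻ (inverseˡ x)) , (λ x → ≈⇒≈ᶻ (inverseʳ x))
      ; ⁻¹-cong = λ {x} {y} e → central-resp
          (begin
            (x ⁻¹ ∙ y) ⁻¹                 ≈⟨ conj-central (x ⁻¹) (⁻¹-central e) ⟨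
            x ⁻¹ ⁻¹ ∙ (x ⁻¹ ∙ y) ⁻¹ ∙ x ⁻¹
              ≈⟨ solve 2 (λ x y → x ⁻ ⁻ ⊙ (x ⁻ ⊙ y) ⁻ ⊙ x ⁻ ⊜ x ⁻ ⁻ ⊙ y ⁻) refl x y ⟩
            x ⁻¹ ⁻¹ ∙ y ⁻¹                ∎)
          (⁻¹-central e)
      }
    }

module _ (G : Group c ℓ) where
  open Group G
  open GroupTheory G
  open GroupTheory G/Z using () renaming (Torsionless to Torsionlessᶻ; Class≤ to Classᶻ≤)

  torsionlessᶻ : Torsionless → ∀ {k} → Class≤ k → Torsionlessᶻ
  torsionlessᶻ tf nil x n e =
    central⇒≈ᶻε (↑-central⇒central tf nil x n (≈ᶻε⇒central e))

  classᶻ≤ : ∀ {k} → Class≤ (suc k) → Classᶻ≤ k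
  classᶻ≤ nil w wₖ =
    central⇒≈ᶻε (λ y → ⁅⁆≈ε⇒commute (nil _ (w , y , wₖ , ≡.refl)))

-- Classical arguments relative to A

module Relative {a} (A : Set a) where

  private variable ℓₚ ℓₓ : Level

  infix 3 ~_
  ~_ : Set ℓₚ → Set (ℓₚ ⊔ a)
  ~ X = X → A

  em : (X : Set ℓₚ) → ~ ~ (X ⊎ ~ X)
  em X k = k (inj₂ λ x → k (inj₁ x))

  ~~-map : {X : Set ℓₚ} {Y : Set ℓₓ} → (X → Y) → ~ ~ X → ~ ~ Y
  ~~-map f xx k = xx λ x → k (f x)

  Stable : Group c ℓ → Set (a ⊔ c ⊔ ℓ)
  Stable G = ∀ {x y} → ~ ~ (x ≈ y) → x ≈ y where open Group G

  -- Every index has a label in a finite list, so two distinct indices share one; the negative form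
  -- needs no decidability of `E`. If the first label occurs at `m`, `apart` bars it from every
  -- later index, and the sequence after `m` has one label fewer; otherwise it drops out at once.
  pigeonhole : ∀ {d e} {D : Set d} (ls : List D) (E : ℕ → D → Set e) →
               (∀ m → ~ ~ Any (E m) ls) → ~ (∀ i d l → E i l → ~ E (suc d + i) l)
  pigeonhole []       E cover apart = cover 0 λ ()
  pigeonhole (l ∷ ls) E cover apart = em (∃[ m ] E m l) λ where
    (inj₂ ¬hit) → pigeonhole ls E
      (λ m k → cover m λ where
        (here e)  → ¬hit (m , e)
        (there i) → k i)
      apart
    (inj₁ (m , hit)) → pigeonhole ls (λ j → E (suc j + m))
      (λ j k → cover (suc j + m) λ where
        (here e)  → apart m j l hit e
        (there i) → k i)
      (λ i d l′ e e′ → apart (suc i + m) d l′ e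
        (≡.subst (λ n → E n l′)
          (≡.cong suc
          (≡.trans (≡.sym (≡.cong (_+ m) (+-suc d i))) (+-assoc d (suc i) m))) e′))

  module _ (G : Group c ℓ) where
    open Group G
    open GroupTheory G

    infix 4 _∈_
    _∈_ : Carrier → List Carrier → Set (a ⊔ c ⊔ ℓ)
    x ∈ xs = ~ ~ Any (x ≈_) xs

    Generated : List Carrier → Set (c ⊔ ℓ)
    Generated S = ∀ x → ∃[ ts ] All (_∈ˡ S) ts × x ≈ ∏ ts

    -- A form of harmonicity: the edge from x labelled t belongs to a family of edges at
    -- x over which the values of f average to the conjugate of f x by t.  The family ys′
    -- plays the same role for t ⁻¹, so that the two commutators with f x cancel.
    record Balanced {X : Set ℓₓ} (S : List Carrier) (next : X → Carrier → X)
                    (f : X → Carrier) : Set (a ⊔ c ⊔ ℓ ⊔ ℓₓ) where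
      field
        values    : List Carrier
        bounded   : ∀ x → f x ∈ values
        reachable : ∀ x y → ∃[ ts ] All (_∈ˡ S) ts × f y ≈ f (foldl next x ts)
        step      : ∀ x {t} → t ∈ˡ S →
                    ∃[ t′ ] t′ ∈ S × f (next x t) ≈ t ⁻¹ ∙ f x ∙ t′
        balance   : ∀ x {t} → t ∈ˡ S → ~ ~ (∃[ ys ] ∃[ ys′ ] length ys′ ≡ suc (length ys)
                    × ∏ (map f (next x t ∷ ys)) ≈ t ⁻¹ ∙ f x ↑ suc (length ys) ∙ t
                    × ∏ (map f ys′) ≈ t ⁻¹ ⁻¹ ∙ f x ↑ suc (length ys) ∙ t ⁻¹)

  module _ (G : Group c ℓ) where
    open Group G
    open GroupTheory G

    ∈-resp : ∀ {x y} xs → x ≈ y → _∈_ G x xs → _∈_ G y xs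
    ∈-resp xs x≈y = ~~-map (Any.map (trans (sym x≈y)))

    ∈⇒∈ᶻ : ∀ {x xs} → _∈_ G x xs → _∈_ G/Z x xs
    ∈⇒∈ᶻ = ~~-map (Any.map ≈⇒≈ᶻ)

    stableᶻ : Stable G → Stable G/Z
    stableᶻ stable e y = stable (~~-map (λ xᶜ → xᶜ y) e)

    generatedᶻ : ∀ {S} → Generated G S → Generated G/Z S
    generatedᶻ generates x with generates x
    ... | ts , ts∈S , e = ts , ts∈S , ≈⇒≈ᶻ e

    balancedᶻ : ∀ {X : Set ℓₓ} {S next} {f : X → Carrier} →
                Balanced G S next f → Balanced G/Z S next f
    balancedᶻ {f = f} B = record
      { values = values
      ; bounded = λ x → ∈⇒∈ᶻ (bounded x)
      ; reachable = λ x y → let ts , ts∈S , e = reachable x y in ts , ts∈S , ≈⇒≈ᶻ e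
      ; step = λ x t∈S → let t′ , t′∈S , e = step x t∈S in t′ , ∈⇒∈ᶻ t′∈S , ≈⇒≈ᶻ e
      ; balance = λ x t∈S → ~~-map
          (λ (ys , ys′ , len , e , e′) → ys , ys′ , len , ≈⇒≈ᶻ e , ≈⇒≈ᶻ e′)
          (balance x t∈S)
      }
      where open Balanced B

  -- Bounded translations and extreme points

  module StableTheory (G : Group c ℓ) (stable : Stable G)
                      (tf : GroupTheory.Torsionless G) where
    open Group G
    open GroupProperties G
    open GroupTheory G
    open SetoidReasoning setoid

    -- Two of the infinitely many translates must coincide, which makes a positive power of `z`
    -- trivial.
    translate : ∀ {t z} L → (∀ m → _∈_ G (t ∙ z ↑ m) L) → z ≈ ε
    translate {t} {z} L cover = stable λ z≉ε →
      pigeonhole L (λ m l → t ∙ z ↑ m ≈ l) cover λ i d l e e′ →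
        z≉ε (tf z d (identityˡ-unique _ (z ↑ i) (∙-cancelˡ t _ _ (begin
          t ∙ (z ↑ suc d ∙ z ↑ i) ≈⟨ ∙-congˡ (↑-+ z (suc d) i) ⟨
          t ∙ z ↑ (suc d + i)     ≈⟨ trans e′ (sym e) ⟩
          t ∙ z ↑ i               ∎))))

    -- An average with the denominator cleared, as roots need not exist in the group. `nontrivial`
    -- excludes the families constant at `v`, the empty one included.
    record Mean (P : Carrier → Set ℓₚ) (v : Carrier) : Set (a ⊔ c ⊔ ℓ ⊔ ℓₚ) where
      constructor mean
      field
        terms      : List Carrier
        all        : All P terms
        average    : v ↑ length terms ≈ ∏ terms
        nontrivial : ~ All (_≈ v) terms

    module Elimination {P : Carrier → Set ℓₚ} (central : ∀ {v} → P v → Central v)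
                       {w} (Pw : P w) where

      P∖w : Carrier → Set (a ⊔ ℓ ⊔ ℓₚ)
      P∖w v = P v × ~ (v ≈ w)

      record Split (ws : List Carrier) : Set (a ⊔ c ⊔ ℓ ⊔ ℓₚ) where
        field
          count    : ℕ
          rest     : List Carrier
          all      : All P∖w rest
          length≡  : length ws ≡ count + length rest
          product  : ∏ ws ≈ w ↑ count ∙ ∏ rest
          empty    : rest ≡ [] → All (_≈ w) ws

      split : ∀ {ws} → All P ws → ~ ~ Split ws
      split [] k = k record
        { count = 0 ; rest = [] ; all = [] ; length≡ = ≡.refl
        ; product = sym (identityˡ _) ; empty = λ _ → [] }
      split {u ∷ ws} (Pu ∷ Pws) k = split Pws λ s → let open Split s in em (u ≈ w) λ where
        (inj₁ u≈w) → k record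
          { count = suc count ; rest = rest ; all = all ; length≡ = ≡.cong suc length≡
          ; product = trans (∙-cong u≈w product) (sym (assoc _ _ _))
          ; empty = λ e → u≈w ∷ empty e }
        (inj₂ u≉w) → k record
          { count = count ; rest = u ∷ rest ; all = (Pu , u≉w) ∷ all
          ; length≡ = ≡.trans (≡.cong suc length≡) (≡.sym (+-suc count (length rest)))
          ; product = begin
              u ∙ ∏ ws                     ≈⟨ ∙-congˡ product ⟩
              u ∙ (w ↑ count ∙ ∏ rest)     ≈⟨ assoc _ _ _ ⟨
              u ∙ w ↑ count ∙ ∏ rest       ≈⟨ ∙-congʳ (central Pu _) ⟩
              w ↑ count ∙ u ∙ ∏ rest       ≈⟨ assoc _ _ _ ⟩
              w ↑ count ∙ (u ∙ ∏ rest)     ∎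
          ; empty = λ () }

      record Multiple (m : ℕ) (vs : List Carrier) : Set (a ⊔ c ⊔ ℓ ⊔ ℓₚ) where
        field
          list     : List Carrier
          all      : All P∖w list
          length≡  : length list ≡ length vs * m
          product  : ∏ list ≈ ∏ vs ↑ m
          constant : ∀ {v} → Central v → All (_≈ v) list → All (_≈ v) vs

      module _ {m ws} (ws∖w : All P∖w ws) (ws≡ : length ws ≡ suc m)
               (w↑≈ : w ↑ length ws ≈ ∏ ws) where

        -- Replaces `u` by `suc m` terms that avoid `w` and average to `u`: the list `ws` when `u`
        -- is `w` itself, repetition otherwise. All blocks have the same length, so the weights of a
        -- mean stay equal.
        block : ∀ {u} → P u → ~ ~ (∃[ us ] All P∖w us × length us ≡ suc m × ∏ us ≈ u ↑ suc m)
        block {u} Pu k = em (u ≈ w) λ where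
          (inj₁ u≈w) → k (ws , ws∖w , ws≡ , (begin
            ∏ ws          ≈⟨ w↑≈ ⟨
            w ↑ length ws ≡⟨ ≡.cong (w ↑_) ws≡ ⟩
            w ↑ suc m     ≈⟨ ↑-cong (suc m) u≈w ⟨
            u ↑ suc m     ∎))
          (inj₂ u≉w) → k (replicate (suc m) u , All.replicate⁺ (suc m) (Pu , u≉w)
                         , length-replicate (suc m) , refl)

        multiple : ∀ {vs} → All P vs → ~ ~ Multiple (suc m) vs
        multiple [] k = k record
          { list = [] ; all = [] ; length≡ = ≡.refl ; product = sym (↑-ε (suc m))
          ; constant = λ _ _ → [] }
        multiple {u ∷ vs} (Pu ∷ Pvs) k =
          multiple Pvs λ s → block Pu λ (us , us∖w , us≡ , ∏us) →
          let open Multiple s in k record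
          { list = us ++ list
          ; all = All.++⁺ us∖w all
          ; length≡ = ≡.trans (length-++ us) (≡.cong₂ _+_ us≡ length≡)
          ; product = begin
              ∏ (us ++ list)           ≈⟨ ∏-++ us list ⟩
              ∏ us ∙ ∏ list            ≈⟨ ∙-cong ∏us product ⟩
              u ↑ suc m ∙ ∏ vs ↑ suc m ≈⟨ ↑-distrib-∙ (suc m) (central Pu _) ⟨
              (u ∙ ∏ vs) ↑ suc m       ∎
          -- If the blocks are constant at `v`, each `u` has the same `suc m`-th power as `v` and
          -- equals it by uniqueness of roots; nontriviality thus survives the substitution.
          ; constant = λ {v} vᶜ es →
              ↑-injective tf m (central Pu v) (begin
                u ↑ suc m     ≈⟨ ∏us ⟨
                ∏ us          ≈⟨ ∏-const (All.++⁻ˡ us es) ⟩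
                v ↑ length us ≡⟨ ≡.cong (v ↑_) us≡ ⟩
                v ↑ suc m     ∎)
              ∷ constant vᶜ (All.++⁻ʳ us es) }

        eliminate : ∀ {v} → P v → Mean P v → ~ ~ Mean P∖w v
        eliminate {v} Pv (mean vs Pvs v↑≈ nontriv) k = multiple Pvs λ s →
          let open Multiple s in k record
          { terms = list
          ; all = all
          ; average = begin
              v ↑ length list           ≡⟨ ≡.cong (v ↑_) length≡ ⟩
              v ↑ (length vs * suc m)   ≈⟨ ↑-* v (length vs) (suc m) ⟩
              (v ↑ length vs) ↑ suc m   ≈⟨ ↑-cong (suc m) v↑≈ ⟩
              ∏ vs ↑ suc m              ≈⟨ product ⟨
              ∏ list                    ∎
          ; nontrivial = λ es → nontriv (constant (central Pv) es) }

    -- A finite set in a torsion-free abelian group has an extreme point: otherwise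
    -- some element w is a mean of the others, and substituting this mean for w
    -- exhibits every other element as a nontrivial mean of the set without w.
    extreme : ∀ L (P : Carrier → Set ℓₚ) → (∀ {v w} → v ≈ w → P v → P w) →
              (∀ {v} → P v → _∈_ G v L) → (∀ {v} → P v → Central v) →
              (∀ {v} → P v → ~ ~ Mean P v) → ∀ {v} → ~ P v
    extreme []      P respects cover central means Pv = cover Pv λ ()
    extreme (w ∷ L) P respects cover central means Pv = em (P w) λ where
      (inj₂ ¬Pw) → extreme L P respects
        (λ {u} Pu k → cover Pu λ where
          (here u≈w)  → ¬Pw (respects u≈w Pu)
          (there u∈L) → k u∈L)
        central means Pv
      (inj₁ Pw) → let open Elimination central Pw in
        means Pw λ (mean ws Pws w↑≈ nontriv) → split Pws λ s →
        remove Pw s w↑≈ nontriv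
     where
      remove : ∀ {ws} (Pw : P w) → Elimination.Split central Pw ws →
               w ↑ length ws ≈ ∏ ws → ~ ~ All (_≈ w) ws
      remove {ws} Pw s w↑≈ nontriv with Elimination.Split.rest s in eq
      -- With nothing left besides copies of `w`, the mean would be constant.
      ... | []     = nontriv (Elimination.Split.empty s eq)
      -- Elimination gives every other element a mean avoiding `w`, so the induction on the list
      -- applies, started from an element of the remainder.
      ... | u ∷ us = extreme L P∖w
        (λ {v} {w} v≈w (Pv , v≉) → respects v≈w Pv , λ w≈ → v≉ (trans v≈w w≈))
        (λ (Pv , v≉w) k → cover Pv λ where
          (here v≈w)  → v≉w v≈w
          (there v∈L) → k v∈L)
        (λ (Pv , _) → central Pv)
        (λ (Pv , _) k → means Pv λ μ → eliminate rest∖w ≡.refl w↑≈∏rest Pv μ k)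
        (All.head rest∖w)
        where
        open Elimination central Pw
        open Split s
        rest∖w : All P∖w (u ∷ us)
        rest∖w = ≡.subst (All P∖w) eq all
        w↑≈∏rest : w ↑ length (u ∷ us) ≈ ∏ (u ∷ us)
        w↑≈∏rest = ≡.subst (λ r → w ↑ length r ≈ ∏ r) eq (∙-cancelˡ (w ↑ count) _ _ (begin
          w ↑ count ∙ w ↑ length rest ≈⟨ ↑-+ w count (length rest) ⟨
          w ↑ (count + length rest)   ≡⟨ ≡.cong (w ↑_) length≡ ⟨
          w ↑ length ws               ≈⟨ w↑≈ ⟩
          ∏ ws                        ≈⟨ product ⟩
          w ↑ count ∙ ∏ rest          ∎))

  -- Rigidity of balanced functions, lifted from the quotient by the center

  module RigidStep (G : Group c ℓ) (stable : Stable G)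
    (tf : GroupTheory.Torsionless G)
    {X : Set ℓₓ} {S : List (Group.Carrier G)} (generates : Generated G S)
    {next : X → Group.Carrier G → X} {f : X → Group.Carrier G}
    (B : Balanced G S next f)
    (constantᶻ : ∀ x y → GroupTheory._≈ᶻ_ G (f x) (f y))
    (centralᶻ : ∀ x → GroupTheory.Central (GroupTheory.G/Z G) (f x))
    where
    open Group G
    open GroupProperties G
    open GroupTheory G
    open StableTheory G stable tf
    open FreeGroupSolver G using (solve; _⊜_; _⊙_; _⁻)
    open SetoidReasoning setoid
    open Balanced B

    -- The commutator of `f x` and `t`, that is, the factor by which conjugation by `t` changes
    -- `f x`; it is central since `f x` is central in `G/Z`.
    κ : X → Carrier → Carrier
    κ x t = f x ⁻¹ ∙ t ⁻¹ ∙ f x ∙ t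

    κ-central : ∀ x t → Central (κ x t)
    κ-central x t = central-resp
      (solve 2 (λ p t → (t ⊙ p) ⁻ ⊙ (p ⊙ t) ⊜ p ⁻ ⊙ t ⁻ ⊙ p ⊙ t) refl (f x) t)
      (Group.sym G/Z (centralᶻ x t))

    module _ (o : X) where

      -- Measured from the base value `f o`, the values of `f` lie in the center, an abelian group
      -- in which `extreme` applies.
      h : X → Carrier
      h x = f o ⁻¹ ∙ f x

      h-central : ∀ x → Central (h x)
      h-central x = constantᶻ o x

      f≈ : ∀ x → f x ≈ f o ∙ h x
      f≈ x = solve 2 (λ g p → p ⊜ g ⊙ (g ⁻ ⊙ p)) refl (f o) (f x)

      h≈⇒f≈ : ∀ {x y} → h x ≈ h y → f x ≈ f y
      h≈⇒f≈ = ∙-cancelˡ (f o ⁻¹) _ _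

      ∏-f : ∀ ys → ∏ (map f ys) ≈ f o ↑ length ys ∙ ∏ (map h ys)
      ∏-f []       = sym (identityˡ ε)
      ∏-f (y ∷ ys) = trans (∙-cong (f≈ y) (∏-f ys)) (interchange (h-central y _))

      ∏-h : ∀ x {z} → Central z → ∀ ys → ∏ (map f ys) ≈ (f x ∙ z) ↑ length ys →
            ∏ (map h ys) ≈ (h x ∙ z) ↑ length ys
      ∏-h x {z} zᶜ ys e = ∙-cancelˡ (f o ↑ length ys) _ _ (begin
        f o ↑ length ys ∙ ∏ (map h ys)          ≈⟨ ∏-f ys ⟨
        ∏ (map f ys)                            ≈⟨ e ⟩
        (f x ∙ z) ↑ length ys                   ≈⟨ ↑-cong (length ys)
          (solve 3 (λ g p z → p ⊙ z ⊜ g ⊙ (g ⁻ ⊙ p ⊙ z)) refl (f o) (f x) z) ⟩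
        (f o ∙ (h x ∙ z)) ↑ length ys
          ≈⟨ ↑-distrib-∙ (length ys) (sym (∙-central (h-central x) zᶜ _)) ⟩
        f o ↑ length ys ∙ (h x ∙ z) ↑ length ys ∎)

      Value : Carrier → Set _
      Value v = ∃[ x ] h x ≈ v

      -- The two families of `balance` average to `f x` times `κ x t` and times its inverse. They
      -- have equal length, so together they average to `f x`; the edge along which `f` changes
      -- makes this mean nontrivial.
      value-mean : ∀ {v} x {t} → t ∈ˡ S → h x ≈ v → ~ (f (next x t) ≈ f x) →
                   ~ ~ Mean Value v
      value-mean {v} x {t} t∈S hx≈v moved = ~~-map average (balance x t∈S)
        where
        average : _ → Mean Value v
        average (ys , ys′ , len , e , e′) = mean (map h zs)
          (All.map⁺ (All.universal (λ y → y , refl) zs))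
          (begin
            v ↑ length (map h zs)          ≡⟨ ≡.cong (v ↑_) length-zs ⟩
            v ↑ (suc n + suc n)            ≈⟨ ↑-cong (suc n + suc n) hx≈v ⟨
            h x ↑ (suc n + suc n)          ≈⟨ ↑-+ (h x) (suc n) (suc n) ⟩
            h x ↑ suc n ∙ h x ↑ suc n      ≈⟨ ↑-distrib-∙ (suc n) refl ⟨
            (h x ∙ h x) ↑ suc n            ≈⟨ ↑-cong (suc n) hh≈ ⟩
            ((h x ∙ k) ∙ (h x ∙ k ⁻¹)) ↑ suc n
              ≈⟨ ↑-distrib-∙ (suc n) (∙-central (h-central x) kᶜ _) ⟩
            (h x ∙ k) ↑ suc n ∙ (h x ∙ k ⁻¹) ↑ suc n
              ≡⟨ ≡.cong (λ m → (h x ∙ k) ↑ suc n ∙ (h x ∙ k ⁻¹) ↑ m) len ⟨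
            (h x ∙ k) ↑ suc n ∙ (h x ∙ k ⁻¹) ↑ length ys′
              ≈⟨ ∙-cong (∏-h x kᶜ Y e₁) (∏-h x (⁻¹-central kᶜ) ys′ e₂) ⟨
            ∏ (map h Y) ∙ ∏ (map h ys′)    ≈⟨ ∏-++ (map h Y) (map h ys′) ⟨
            ∏ (map h Y ++ map h ys′)       ≡⟨ ≡.cong ∏ (map-++ h Y ys′) ⟨
            ∏ (map h zs)                   ∎)
          (λ es → moved (h≈⇒f≈ (trans (All.head es) (sym hx≈v))))
          where
          n = length ys
          Y = next x t ∷ ys
          zs = Y ++ ys′
          k = κ x t
          kᶜ = κ-central x t
          length-zs : length (map h zs) ≡ suc n + suc n
          length-zs = ≡.trans (length-map h zs) (≡.trans (length-++ Y) (≡.cong (suc n +_) len))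
          hh≈ : h x ∙ h x ≈ (h x ∙ k) ∙ (h x ∙ k ⁻¹)
          hh≈ = trans (solve 2 (λ h k → h ⊙ h ⊜ h ⊙ k ⊙ (k ⁻ ⊙ h)) refl (h x) k)
                  (∙-congˡ (⁻¹-central kᶜ _))
          e₁ : ∏ (map f Y) ≈ (f x ∙ k) ↑ suc n
          e₁ = begin
            ∏ (map f Y)                ≈⟨ e ⟩
            t ⁻¹ ∙ f x ↑ suc n ∙ t     ≈⟨ ↑-conj (suc n) t (f x) ⟨
            (t ⁻¹ ∙ f x ∙ t) ↑ suc n   ≈⟨ ↑-cong (suc n)
              (solve 2 (λ p t → t ⁻ ⊙ p ⊙ t ⊜ p ⊙ (p ⁻ ⊙ t ⁻ ⊙ p ⊙ t)) refl (f x) t) ⟩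
            (f x ∙ k) ↑ suc n          ∎
          conj≈ : t ⁻¹ ⁻¹ ∙ f x ∙ t ⁻¹ ≈ f x ∙ k ⁻¹
          conj≈ = begin
            t ⁻¹ ⁻¹ ∙ f x ∙ t ⁻¹
              ≈⟨ solve 2 (λ p t → t ⁻ ⁻ ⊙ p ⊙ t ⁻ ⊜ p ⊙ (t ⁻ ⁻ ⊙ (p ⁻ ⊙ t ⁻ ⊙ p ⊙ t) ⁻ ⊙ t ⁻))
                   refl (f x) t ⟩
            f x ∙ (t ⁻¹ ⁻¹ ∙ k ⁻¹ ∙ t ⁻¹)
              ≈⟨ ∙-congˡ (conj-central (t ⁻¹) (⁻¹-central kᶜ)) ⟩
            f x ∙ k ⁻¹           ∎
          e₂ : ∏ (map f ys′) ≈ (f x ∙ k ⁻¹) ↑ length ys′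
          e₂ = begin
            ∏ (map f ys′)                    ≈⟨ e′ ⟩
            t ⁻¹ ⁻¹ ∙ f x ↑ suc n ∙ t ⁻¹     ≈⟨ ↑-conj (suc n) (t ⁻¹) (f x) ⟨
            (t ⁻¹ ⁻¹ ∙ f x ∙ t ⁻¹) ↑ suc n   ≈⟨ ↑-cong (suc n) conj≈ ⟩
            (f x ∙ k ⁻¹) ↑ suc n             ≡⟨ ≡.cong ((f x ∙ k ⁻¹) ↑_) len ⟨
            (f x ∙ k ⁻¹) ↑ length ys′        ∎

    -- The maximum principle. If `f` were not constant, every value of `h` would be a nontrivial
    -- mean, against `extreme`: a value that is not one cannot change along any edge, and
    -- `reachable` spreads it to all of `X`.
    constant : ∀ x y → f x ≈ f y
    constant o y = stable λ fo≉fy →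
      extreme (map (f o ⁻¹ ∙_) values) (Value o)
        (λ v≈w (x , e) → x , trans e v≈w)
        (λ (x , e) → ∈-resp G _ e (~~-map (λ i → Any.map⁺ (Any.map ∙-congˡ i)) (bounded x)))
        (λ (x , e) → central-resp e (h-central o x))
        (λ (z , e) noMean →
          let all≈ = everywhere z λ x≈z t∈S moved →
                       value-mean o _ t∈S (trans (∙-congˡ x≈z) e) moved noMean
          in fo≉fy (trans (all≈ o) (sym (all≈ y))))
        (o , refl)
      where
      everywhere : ∀ z → (∀ {x t} → f x ≈ f z → t ∈ˡ S → ~ ~ (f (next x t) ≈ f x)) →
                   ∀ x → f x ≈ f z
      everywhere z stay x = let ts , ts∈S , fx≈ = reachable z x in trans fx≈ (walk ts∈S refl)
        where
        walk : ∀ {x ts} → All (_∈ˡ S) ts → f x ≈ f z → f (foldl next x ts) ≈ f z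
        walk []           x≈z = x≈z
        walk (t∈S ∷ ts∈S) x≈z = walk ts∈S (trans (stable (stay x≈z t∈S)) x≈z)

    -- For constant `f` with value `p`, `step` says that conjugation by `p` maps `S` into itself. It
    -- multiplies a generator `t` by a central commutator `z`, so all `t ∙ z ↑ m` lie in `S` and
    -- `translate` applies.
    central : ∀ x → Central (f x)
    central x = λ y → let ts , ts∈S , y≈ = generates y in
      sym (commute-resp (sym y≈) (∏-commute (All.map commutes ts∈S)))
      where
      p = f x

      conj : Carrier → Carrier
      conj u = p ⁻¹ ∙ u ∙ p

      conj-∈ : ∀ {u} → _∈_ G u S → _∈_ G (conj u) S
      conj-∈ u∈S k = u∈S λ i → let
          t , t∈S , u≈t = find i
          t′ , t′∈S , e = step x t∈S
        in ∈-resp G S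
          (begin
            t′                           ≈⟨ solve 3 (λ p t t′ → t′ ⊜ p ⁻ ⊙ t ⊙ (t ⁻ ⊙ p ⊙ t′)) refl p t t′ ⟩
            p ⁻¹ ∙ t ∙ (t ⁻¹ ∙ p ∙ t′)   ≈⟨ ∙-cong (∙-congˡ (sym u≈t)) (trans (sym e) (constant _ _)) ⟩
            conj _                       ∎) t′∈S k

      commutes : ∀ {t} → t ∈ˡ S → Commute t p
      commutes {t} t∈S = begin
        t ∙ p              ≈⟨ solve 2 (λ p t → t ⊙ p ⊜ p ⊙ t ⊙ (t ⁻ ⊙ p ⁻ ⊙ t ⊙ p)) refl p t ⟩
        p ∙ t ∙ z          ≈⟨ ∙-congˡ z≈ε ⟩
        p ∙ t ∙ ε          ≈⟨ identityʳ _ ⟩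
        p ∙ t              ∎
        where
        z = t ⁻¹ ∙ p ⁻¹ ∙ t ∙ p
        zᶜ : Central z
        zᶜ = central-resp (solve 2 (λ p t → (p ⁻ ⊙ t ⁻ ⊙ p ⊙ t) ⁻ ⊜ t ⁻ ⊙ p ⁻ ⊙ t ⊙ p) refl p t)
               (⁻¹-central (κ-central x t))
        powers-∈ : ∀ m → _∈_ G (t ∙ z ↑ m) S
        powers-∈ zero    = ∈-resp G S (sym (identityʳ t)) (λ k → k (Any.map reflexive t∈S))
        powers-∈ (suc m) = ∈-resp G S (begin
          p ⁻¹ ∙ (t ∙ z ↑ m) ∙ p
            ≈⟨ solve 3 (λ p t y → p ⁻ ⊙ (t ⊙ y) ⊙ p ⊜ p ⁻ ⊙ t ⊙ p ⊙ (p ⁻ ⊙ y ⊙ p)) refl p t (z ↑ m) ⟩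
          p ⁻¹ ∙ t ∙ p ∙ (p ⁻¹ ∙ z ↑ m ∙ p)
            ≈⟨ ∙-congˡ (conj-central p (λ y → ↑-commute m (zᶜ y))) ⟩
          p ⁻¹ ∙ t ∙ p ∙ z ↑ m
            ≈⟨ solve 3 (λ p t y → p ⁻ ⊙ t ⊙ p ⊙ y ⊜ t ⊙ (t ⁻ ⊙ p ⁻ ⊙ t ⊙ p ⊙ y)) refl p t (z ↑ m) ⟩
          t ∙ (z ∙ z ↑ m)         ∎) (conj-∈ (powers-∈ m))
        z≈ε : z ≈ ε
        z≈ε = translate S powers-∈

  record Admissible (k : ℕ) (G : Group c ℓ) (S : List (Group.Carrier G)) :
                    Set (a ⊔ c ⊔ ℓ) where
    open Group G
    open GroupTheory G
    field
      stable      : Stable G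
      torsionless : Torsionless
      class≤      : Class≤ k
      generated   : Generated G S
      symmetric   : ∀ {s} → s ∈ˡ S → _∈_ G (s ⁻¹) S

  admissibleᶻ : ∀ {k} (G : Group c ℓ) {S} → Admissible (suc k) G S →
                Admissible k (GroupTheory.G/Z G) S
  admissibleᶻ G adm = record
    { stable      = stableᶻ G stable
    ; torsionless = torsionlessᶻ G torsionless class≤
    ; class≤      = classᶻ≤ G class≤
    ; generated   = generatedᶻ G generated
    ; symmetric   = λ s∈S → ∈⇒∈ᶻ G (symmetric s∈S)
    }
    where open Admissible adm

  -- Induction on the class bound: passing to the quotient changes only the equality, so the same
  -- `f` and `next` serve there, and a bound of zero means a trivial group.
  rigid : ∀ k (G : Group c ℓ) {S} → Admissible k G S →
          let open Group G in
          ∀ {X : Set ℓₓ} {next} {f : X → Carrier} → Balanced G S next f →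
          (∀ x y → f x ≈ f y) × (∀ x → GroupTheory.Central G (f x))
  rigid zero G adm {f = f} B =
    (λ x y → trans (trivial _) (sym (trivial _))) ,
    (λ x y → trans (trivial _) (sym (trivial _)))
    where
    open Group G
    open Admissible adm
    trivial : ∀ w → w ≈ ε
    trivial w = class≤ w tt
  rigid (suc k) G adm B = constant , central
    where
    open Admissible adm
    IH = rigid k (GroupTheory.G/Z G) (admissibleᶻ G adm) (balancedᶻ G B)
    open RigidStep G stable torsionless generated B (proj₁ IH) (proj₂ IH)

  -- Isomorphisms of Cayley graphs

  record GraphIso (G₁ : Group c₁ ℓ₁) (S₁ : List (Group.Carrier G₁))
                  (G₂ : Group c₂ ℓ₂) (S₂ : List (Group.Carrier G₂)) :
                  Set (a ⊔ c₁ ⊔ ℓ₁ ⊔ c₂ ⊔ ℓ₂) where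
    private
      module G₁ = Group G₁
      module G₂ = Group G₂
    field
      to        : G₁.Carrier → G₂.Carrier
      from      : G₂.Carrier → G₁.Carrier
      to-cong   : ∀ {x y} → x G₁.≈ y → to x G₂.≈ to y
      from-cong : ∀ {x y} → x G₂.≈ y → from x G₁.≈ from y
      to-from   : ∀ x → to (from x) G₂.≈ x
      from-to   : ∀ x → from (to x) G₁.≈ x
      to-∈      : ∀ x {s} → _∈_ G₁ s S₁ → _∈_ G₂ (to x G₂.⁻¹ G₂.∙ to (x G₁.∙ s)) S₂
      from-∈    : ∀ x {s} → _∈_ G₂ s S₂ → _∈_ G₁ (from x G₁.⁻¹ G₁.∙ from (x G₂.∙ s)) S₁

  symIso : ∀ {G₁ : Group c₁ ℓ₁} {S₁} {G₂ : Group c₂ ℓ₂} {S₂} →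
            GraphIso G₁ S₁ G₂ S₂ → GraphIso G₂ S₂ G₁ S₁
  symIso φ = record
    { to = from ; from = to ; to-cong = from-cong ; from-cong = to-cong
    ; to-from = from-to ; from-to = to-from ; to-∈ = from-∈ ; from-∈ = to-∈ }
    where open GraphIso φ

  module _ {G₁ : Group c₁ ℓ₁} {S₁} {G₂ : Group c₂ ℓ₂} {S₂} (φ : GraphIso G₁ S₁ G₂ S₂) where
    open GraphIso φ
    open Group G₂
    private
      module G₁ where
        open Group G₁ public
        open GroupTheory G₁ public
        open FreeGroupSolver G₁ public using (solve; _⊜_; _⊙_; _⁻)
    open GroupProperties G₂
    open GroupTheory G₂
    open FreeGroupSolver G₂ using (solve; _⊜_; _⊙_; _⁻; one)
    open SetoidReasoning setoid

    -- The increment of the graph isomorphism along `w`; once it is independent of `x`, the map is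
    -- affine.
    δ : G₁.Carrier → G₁.Carrier → Carrier
    δ x w = to x ⁻¹ ∙ to (x G₁.∙ w)

    δ-cong : ∀ x {v w} → v G₁.≈ w → δ x v ≈ δ x w
    δ-cong x v≈w = ∙-congˡ (to-cong (G₁.∙-congˡ v≈w))

    δ-ε : ∀ x → δ x G₁.ε ≈ ε
    δ-ε x = trans (∙-congˡ (to-cong (G₁.identityʳ x))) (inverseˡ _)

    δ-∙ : ∀ x v w → δ x (v G₁.∙ w) ≈ δ x v ∙ δ (x G₁.∙ v) w
    δ-∙ x v w = begin
      to x ⁻¹ ∙ to (x G₁.∙ (v G₁.∙ w))  ≈⟨ ∙-congˡ (to-cong (G₁.assoc x v w)) ⟨
      to x ⁻¹ ∙ to (x G₁.∙ v G₁.∙ w)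
        ≈⟨ solve 3 (λ p q r → p ⁻ ⊙ r ⊜ p ⁻ ⊙ q ⊙ (q ⁻ ⊙ r)) refl _ (to (x G₁.∙ v)) _ ⟩
      δ x v ∙ δ (x G₁.∙ v) w            ∎

    -- By `δ-∙` the increment is a product of one element of `S₂` per letter, from whatever vertex
    -- the word is read.
    δ-bounded : ∀ {ts} → All (_∈ˡ S₁) ts → ∃[ L ] ∀ x → _∈_ G₂ (δ x (G₁.∏ ts)) L
    δ-bounded []           = ε ∷ [] , λ x k → k (here (δ-ε x))
    δ-bounded {t ∷ ts} (t∈S ∷ ts∈S) = let L , bound = δ-bounded ts∈S in
      cartesianProductWith _∙_ S₂ L , λ x k →
        to-∈ x (λ k → k (Any.map G₁.reflexive t∈S)) λ i → bound (x G₁.∙ t) λ j →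
        k (Any.cartesianProductWith⁺ _∙_
            (λ p q → trans (δ-∙ x t (G₁.∏ ts)) (∙-cong p q)) i j)

    -- Right multiplication by a central z moves every vertex a bounded distance,
    -- and so does the automorphism Ψ of the second graph that it induces.
    module Shift (symmetric : ∀ {s} → s ∈ˡ S₂ → _∈_ G₂ (s ⁻¹) S₂)
                 (gen₁ : Generated G₁ S₁) (gen₂ : Generated G₂ S₂)
                 {z} (zᶜ : G₁.Central z) where

      Ψ : Carrier → Carrier
      Ψ u = to (from u G₁.∙ z)

      f : Carrier → Carrier
      f u = u ⁻¹ ∙ Ψ u

      f-cong : ∀ {u v} → u ≈ v → f u ≈ f v
      f-cong u≈v = ∙-cong (⁻¹-cong u≈v) (to-cong (G₁.∙-congʳ (from-cong u≈v)))

      f-to : ∀ x → f (to x) ≈ δ x z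
      f-to x = ∙-congˡ (to-cong (G₁.∙-congʳ (from-to x)))

      -- The label at `Ψ u` of the image under `Ψ` of the edge at `u` labelled `t`. Being injective
      -- on the finite set `S₂`, it permutes the labels, and its orbits supply the families of
      -- `balance`.
      T : Carrier → Carrier → Carrier
      T u t = Ψ u ⁻¹ ∙ Ψ (u ∙ t)

      f-step : ∀ u t → f (u ∙ t) ≈ t ⁻¹ ∙ f u ∙ T u t
      f-step u t = solve 4 (λ u t p q → (u ⊙ t) ⁻ ⊙ q ⊜ t ⁻ ⊙ (u ⁻ ⊙ p) ⊙ (p ⁻ ⊙ q))
        refl u t (Ψ u) (Ψ (u ∙ t))

      -- Here centrality of `z` enters: the label `s` of the edge from `from u` to `from (u ∙ t)` is
      -- also the label between their translates by `z`.
      T-∈ : ∀ u {t} → _∈_ G₂ t S₂ → _∈_ G₂ (T u t) S₂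
      T-∈ u {t} t∈S = ∈-resp G₂ S₂ (∙-congˡ (to-cong e))
        (to-∈ (from u G₁.∙ z) (from-∈ u t∈S))
        where
        s = from u G₁.⁻¹ G₁.∙ from (u ∙ t)
        e : from u G₁.∙ z G₁.∙ s G₁.≈ from (u ∙ t) G₁.∙ z
        e = G₁.trans (G₁.assoc _ _ _) (G₁.trans (G₁.∙-congˡ (zᶜ s))
          (G₁.solve 3 (λ x y z → x G₁.⊙ (x G₁.⁻ G₁.⊙ y G₁.⊙ z) G₁.⊜ y G₁.⊙ z) G₁.refl
            (from u) (from (u ∙ t)) z))

      to-injective : ∀ {x y} → to x ≈ to y → x G₁.≈ y
      to-injective e = G₁.trans (G₁.sym (from-to _)) (G₁.trans (from-cong e) (from-to _))

      from-injective : ∀ {u v} → from u G₁.≈ from v → u ≈ v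
      from-injective e = trans (sym (to-from _)) (trans (to-cong e) (to-from _))

      T-injective : ∀ u {s t} → T u s ≈ T u t → s ≈ t
      T-injective u e = ∙-cancelˡ u _ _ (from-injective
        (GroupProperties.∙-cancelʳ G₁ z _ _ (to-injective (∙-cancelˡ (Ψ u ⁻¹) _ _ e))))

      module _ (u : Carrier) where

        iterate : Carrier → ℕ → Carrier
        iterate t zero    = t
        iterate t (suc n) = iterate (T u t) n

        iterate-+ : ∀ t m n → iterate t (m + n) ≡ iterate (iterate t m) n
        iterate-+ t zero    n = ≡.refl
        iterate-+ t (suc m) n = iterate-+ (T u t) m n

        iterate-∈ : ∀ n {t} → _∈_ G₂ t S₂ → _∈_ G₂ (iterate t n) S₂
        iterate-∈ zero    t∈S = t∈S
        iterate-∈ (suc n) t∈S = iterate-∈ n (T-∈ u t∈S)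

        iterate-injective : ∀ n {s t} → iterate s n ≈ iterate t n → s ≈ t
        iterate-injective zero    e = e
        iterate-injective (suc n) e = T-injective u (iterate-injective n e)

        -- Injectivity cancels the preperiod `i`.
        periodic : ∀ {t} i d → iterate t i ≈ iterate t (suc d + i) → iterate t (suc d) ≈ t
        periodic {t} i d e =
          sym (iterate-injective i (trans e (reflexive (iterate-+ t (suc d) i))))

        orbit : Carrier → ℕ → List Carrier
        orbit t zero    = []
        orbit t (suc n) = u ∙ t ∷ orbit (T u t) n

        length-orbit : ∀ t n → length (orbit t n) ≡ n
        length-orbit t zero    = ≡.refl
        length-orbit t (suc n) = ≡.cong suc (length-orbit (T u t) n)

        -- By `f-step` the product telescopes: each factor ends in the label whose inverse opens the
        -- next.
        ∏-orbit : ∀ t n → ∏ (map f (orbit t n)) ≈ t ⁻¹ ∙ f u ↑ n ∙ iterate t n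
        ∏-orbit t zero    = solve 1 (λ t → one ⊜ t ⁻ ⊙ one ⊙ t) refl t
        ∏-orbit t (suc n) = trans (∙-cong (f-step u t) (∏-orbit (T u t) n))
          (solve 5 (λ t p q r s → t ⁻ ⊙ p ⊙ q ⊙ (q ⁻ ⊙ r ⊙ s) ⊜ t ⁻ ⊙ (p ⊙ r) ⊙ s) refl
            t (f u) (T u t) (f u ↑ n) (iterate t (suc n)))

        ∏-period : ∀ t n → iterate t n ≈ t → ∏ (map f (orbit t n)) ≈ t ⁻¹ ∙ f u ↑ n ∙ t
        ∏-period t n e = trans (∏-orbit t n) (∙-congˡ e)

      balanced : Balanced G₂ S₂ _∙_ f
      balanced = record
        { values = proj₁ bound
        ; bounded = λ u → ∈-resp G₂ (proj₁ bound)
            (trans (sym (trans (f-to (from u)) (δ-cong (from u) z≈))) (f-cong (to-from u)))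
            (proj₂ bound (from u))
        ; reachable = λ u v → let ts , ts∈S , e = gen₂ (u ⁻¹ ∙ v) in
            ts , ts∈S , f-cong (begin
              v                 ≈⟨ solve 2 (λ u v → v ⊜ u ⊙ (u ⁻ ⊙ v)) refl u v ⟩
              u ∙ (u ⁻¹ ∙ v)    ≈⟨ ∙-congˡ e ⟩
              u ∙ ∏ ts          ≈⟨ foldl-∙ u ts ⟩
              foldl _∙_ u ts    ∎)
        ; step = λ u {t} t∈S → T u t , T-∈ u (∈ˡ⇒∈ t∈S) , f-step u t
        ; balance = λ u {t} t∈S k →
            -- Tracking the orbits of `t` and `t ⁻¹` as pairs yields a common period `suc d`, so
            -- that the two families have equal length.
            pigeonhole (cartesianProduct S₂ S₂)
              (λ m (l , l′) → iterate u t m ≈ l × iterate u (t ⁻¹) m ≈ l′)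
              (λ m k → iterate-∈ u m (∈ˡ⇒∈ t∈S) λ i → iterate-∈ u m (symmetric t∈S) λ j →
                k (Any.cartesianProduct⁺ i j))
              λ i d (l , l′) (e₁ , e₁′) (e₂ , e₂′) → k
                -- The first orbit omits its initial vertex `u ∙ t`, which `balance` adds as
                -- `next x t`; hence `d` terms against `suc d`.
                ( orbit u (T u t) d , orbit u (t ⁻¹) (suc d)
                , ≡.trans (length-orbit u (t ⁻¹) (suc d)) (≡.cong suc (≡.sym (len u t d)))
                , trans (∏-period u t (suc d) (periodic u i d (trans e₁ (sym e₂))))
                    (reflexive (≡.cong (λ n → t ⁻¹ ∙ f u ↑ suc n ∙ t) (≡.sym (len u t d))))
                , trans (∏-period u (t ⁻¹) (suc d) (periodic u i d (trans e₁′ (sym e₂′))))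
                    (reflexive (≡.cong (λ n → t ⁻¹ ⁻¹ ∙ f u ↑ suc n ∙ t ⁻¹)
                      (≡.sym (len u t d)))))
        }
        where
        len : ∀ u t d → length (orbit u (T u t) d) ≡ d
        len u t d = length-orbit u (T u t) d
        word = gen₁ z
        z≈ = proj₂ (proj₂ word)
        bound = δ-bounded (proj₁ (proj₂ word))
        ∈ˡ⇒∈ : ∀ {t} → t ∈ˡ S₂ → _∈_ G₂ t S₂
        ∈ˡ⇒∈ t∈S k = k (Any.map reflexive t∈S)
        foldl-∙ : ∀ u ts → u ∙ ∏ ts ≈ foldl _∙_ u ts
        foldl-∙ u []       = identityʳ u
        foldl-∙ u (t ∷ ts) = trans (sym (assoc u t (∏ ts))) (foldl-∙ (u ∙ t) ts)

    -- Descent to the quotients by the centers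

    module _ (gen₁ : Generated G₁ S₁) {k} (adm₂ : Admissible k G₂ S₂)
             {z} (zᶜ : G₁.Central z) where
      open Admissible adm₂
      open Shift symmetric gen₁ generated zᶜ

      δ-central-constant : ∀ x y → δ x z ≈ δ y z
      δ-central-constant x y =
        trans (sym (f-to x)) (trans (proj₁ (rigid k G₂ adm₂ balanced) (to x) (to y)) (f-to y))

      δ-central : ∀ x → Central (δ x z)
      δ-central x = central-resp (f-to x) (proj₂ (rigid k G₂ adm₂ balanced) (to x))

    to-congᶻ : Generated G₁ S₁ → ∀ {k} → Admissible k G₂ S₂ →
               ∀ {x y} → x G₁.≈ᶻ y → to x ≈ᶻ to y
    to-congᶻ gen₁ adm₂ {x} {y} e = central-resp
      (∙-congˡ (to-cong (G₁.solve 2 (λ x y → x G₁.⊙ (x G₁.⁻ G₁.⊙ y) G₁.⊜ y) G₁.refl x y)))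
      (δ-central gen₁ adm₂ e x)

    to-∈ᶻ : Generated G₁ S₁ → ∀ {k} → Admissible k G₂ S₂ →
            ∀ x {s} → _∈_ G₁.G/Z s S₁ → _∈_ G/Z (δ x s) S₂
    to-∈ᶻ gen₁ adm₂ x s∈S k = s∈S λ i → let l , l∈S , e = find i in
      ∈-resp G/Z S₂ 
        (Group.∙-congˡ G/Z (to-congᶻ gen₁ adm₂
          (Group.∙-congˡ G₁.G/Z (Group.sym G₁.G/Z e))))
        (∈⇒∈ᶻ G₂ (to-∈ x λ k → k (Any.map G₁.reflexive l∈S))) k

  isoᶻ : ∀ {G₁ : Group c₁ ℓ₁} {S₁} {G₂ : Group c₂ ℓ₂} {S₂ k₁ k₂} →
         Admissible k₁ G₁ S₁ → Admissible k₂ G₂ S₂ → GraphIso G₁ S₁ G₂ S₂ →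
         GraphIso (GroupTheory.G/Z G₁) S₁ (GroupTheory.G/Z G₂) S₂
  isoᶻ {G₁ = G₁} {G₂ = G₂} adm₁ adm₂ φ = record
    { to = to ; from = from
    ; to-cong = to-congᶻ φ (generated adm₁) adm₂
    ; from-cong = to-congᶻ (symIso φ) (generated adm₂) adm₁
    ; to-from = λ x → GroupTheory.≈⇒≈ᶻ G₂ (to-from x)
    ; from-to = λ x → GroupTheory.≈⇒≈ᶻ G₁ (from-to x)
    ; to-∈ = to-∈ᶻ φ (generated adm₁) adm₂
    ; from-∈ = to-∈ᶻ (symIso φ) (generated adm₂) adm₁
    }
    where
    open GraphIso φ
    open Admissible

  -- Lifting constant increments from the quotients

  module Lift {G₁ : Group c₁ ℓ₁} {S₁} {G₂ : Group c₂ ℓ₂} {S₂} {k₁ k₂}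
    (adm₁ : Admissible k₁ G₁ S₁) (adm₂ : Admissible k₂ G₂ S₂)
    (φ : GraphIso G₁ S₁ G₂ S₂)
    (constantᶻ : ∀ x y w → GroupTheory._≈ᶻ_ G₂ (δ φ x w) (δ φ y w))
    where
    private
      module G₁ where
        open Group G₁ public
        open GroupTheory G₁ public
        open FreeGroupSolver G₁ public using (solve; _⊜_; _⊙_; _⁻)
      δ′ = δ φ
    open GraphIso φ
    open Group G₂
    open GroupProperties G₂
    open GroupTheory G₂
    open FreeGroupSolver G₂ using (solve; _⊜_; _⊙_; _⁻)
    open SetoidReasoning setoid
    open Admissible

    module _ (x y : G₁.Carrier) {s} (s∈S : s ∈ˡ S₁) where

      z : Carrier
      z = δ′ x s ⁻¹ ∙ δ′ y s

      zᶜ : Central z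
      zᶜ = constantᶻ x y s

      -- If u ∈ S₂ lies over the same element of G₂/Z as δ x s, then the edge
      -- labelled u at to x comes from an edge labelled s v at x with v central, and
      -- the edge labelled s v at y then shows u z ∈ S₂.
      shift : ∀ {u} → δ′ x s ≈ᶻ u → _∈_ G₂ u S₂ → _∈_ G₂ (u ∙ z) S₂
      shift {u} δ≈u u∈S = ∈-resp G₂ S₂ (begin
          δ′ y (x G₁.⁻¹ G₁.∙ q)
            ≈⟨ δ-cong φ y (G₁.solve 3 (λ x s q →
                 x G₁.⁻ G₁.⊙ q G₁.⊜ s G₁.⊙ ((x G₁.⊙ s) G₁.⁻ G₁.⊙ q)) G₁.refl x s q) ⟩
          δ′ y (s G₁.∙ v)
            ≈⟨ δ-∙ φ y s v ⟩
          δ′ y s ∙ δ′ (y G₁.∙ s) v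
            -- Since `v` is central, its increment is the same from `y ∙ s` as from `x ∙ s`.
            ≈⟨ ∙-congˡ (δ-central-constant φ (generated adm₁) adm₂ vᶜ _ _) ⟩
          δ′ y s ∙ δ′ (x G₁.∙ s) v
            ≈⟨ ∙-congˡ δv≈ ⟩
          δ′ y s ∙ (δ′ x s ⁻¹ ∙ u)
            ≈⟨ solve 3 (λ p q u → q ⊙ (p ⁻ ⊙ u) ⊜ p ⊙ ((p ⁻ ⊙ q) ⊙ (p ⁻ ⊙ u))) refl
                 (δ′ x s) (δ′ y s) u ⟩
          δ′ x s ∙ (z ∙ (δ′ x s ⁻¹ ∙ u))
            ≈⟨ ∙-congˡ (zᶜ _) ⟩
          δ′ x s ∙ (δ′ x s ⁻¹ ∙ u ∙ z)
            ≈⟨ solve 3 (λ p u z → p ⊙ (p ⁻ ⊙ u ⊙ z) ⊜ u ⊙ z) refl (δ′ x s) u z ⟩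
          u ∙ z
            ∎)
        (to-∈ y x⁻¹q∈S)
        where
        q = from (to x ∙ u)
        v = (x G₁.∙ s) G₁.⁻¹ G₁.∙ q
        vᶜ : G₁.Central v
        vᶜ = Group.trans G₁.G/Z (G₁.≈⇒≈ᶻ (G₁.sym (from-to _)))
               (to-congᶻ (symIso φ) (generated adm₂) adm₁ (central-resp
                 (solve 3 (λ p r u → (p ⁻ ⊙ r) ⁻ ⊙ u ⊜ r ⁻ ⊙ (p ⊙ u)) refl (to x) _ u) δ≈u))
        δv≈ : δ′ (x G₁.∙ s) v ≈ δ′ x s ⁻¹ ∙ u
        δv≈ = begin
          to (x G₁.∙ s) ⁻¹ ∙ to (x G₁.∙ s G₁.∙ v)
            ≈⟨ ∙-congˡ (to-cong (G₁.solve 2 (λ p q →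
                 p G₁.⊙ (p G₁.⁻ G₁.⊙ q) G₁.⊜ q) G₁.refl (x G₁.∙ s) q)) ⟩
          to (x G₁.∙ s) ⁻¹ ∙ to q               ≈⟨ ∙-congˡ (to-from _) ⟩
          to (x G₁.∙ s) ⁻¹ ∙ (to x ∙ u)
            ≈⟨ solve 3 (λ p r u → r ⁻ ⊙ (p ⊙ u) ⊜ (p ⁻ ⊙ r) ⁻ ⊙ u) refl (to x) _ u ⟩
          δ′ x s ⁻¹ ∙ u                         ∎
        x⁻¹q∈S : _∈_ G₁ (x G₁.⁻¹ G₁.∙ q) S₁
        x⁻¹q∈S = ∈-resp G₁ S₁ (G₁.∙-congʳ (G₁.⁻¹-cong (from-to x))) (from-∈ (to x) u∈S)

      shifts : ∀ m → _∈_ G₂ (δ′ x s ∙ z ↑ m) S₂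
      shifts zero    = ∈-resp G₂ S₂ (sym (identityʳ _))
                         (to-∈ x (λ k → k (Any.map G₁.reflexive s∈S)))
      shifts (suc m) = ∈-resp G₂ S₂
        (trans (assoc _ _ _) (∙-congˡ (↑-commute m refl)))
        -- Multiplying by powers of the central `z` does not leave the class modulo the center, so
        -- `shift` can be iterated.
        (shift (central⇒≈ᶻ (λ y → ↑-commute m (zᶜ y))) (shifts m))

      δ-generator-constant : δ′ x s ≈ δ′ y s
      δ-generator-constant = begin
        δ′ x s      ≈⟨ identityʳ _ ⟨
        δ′ x s ∙ ε  ≈⟨ ∙-congˡ z≈ε ⟨
        δ′ x s ∙ z  ≈⟨ solve 2 (λ p q → p ⊙ (p ⁻ ⊙ q) ⊜ q) refl (δ′ x s) (δ′ y s) ⟩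
        δ′ y s      ∎
        where
        z≈ε : z ≈ ε
        z≈ε = StableTheory.translate G₂ (stable adm₂) (torsionless adm₂) S₂ shifts

    δ-word-constant : ∀ {ts} → All (_∈ˡ S₁) ts → ∀ x y → δ′ x (G₁.∏ ts) ≈ δ′ y (G₁.∏ ts)
    δ-word-constant []           x y = trans (δ-ε φ x) (sym (δ-ε φ y))
    δ-word-constant (t∈S ∷ ts∈S) x y = trans (δ-∙ φ x _ _) (trans
      (∙-cong (δ-generator-constant x y t∈S) (δ-word-constant ts∈S _ _))
      (sym (δ-∙ φ y _ _)))

    constant : ∀ x y w → δ′ x w ≈ δ′ y w
    constant x y w = let ts , ts∈S , w≈ = generated adm₁ w in
      trans (δ-cong φ x w≈) (trans (δ-word-constant ts∈S x y) (δ-cong φ y (G₁.sym w≈)))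

  -- Induction on both class bounds at once, as each step divides both groups by their centers. The
  -- bounds need not agree: when either reaches zero, `w` or the second group is trivial.
  δ-constant : ∀ k₁ k₂ {G₁ : Group c₁ ℓ₁} {S₁} {G₂ : Group c₂ ℓ₂} {S₂} →
               Admissible k₁ G₁ S₁ → Admissible k₂ G₂ S₂ → (φ : GraphIso G₁ S₁ G₂ S₂) →
               ∀ x y w → Group._≈_ G₂ (δ φ x w) (δ φ y w)
  δ-constant zero k₂ {G₁} {G₂ = G₂} adm₁ adm₂ φ x y w =
    G₂.trans (trivial x) (G₂.sym (trivial y))
    where
    module G₁ = Group G₁
    module G₂ = Group G₂
    trivial : ∀ x → δ φ x w G₂.≈ G₂.ε
    trivial x = G₂.trans (δ-cong φ x (Admissible.class≤ adm₁ w tt)) (δ-ε φ x)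
  δ-constant (suc k₁) zero {G₂ = G₂} adm₁ adm₂ φ x y w =
    G₂.trans (trivial _) (G₂.sym (trivial _))
    where
    module G₂ = Group G₂
    trivial : ∀ u → u G₂.≈ G₂.ε
    trivial u = Admissible.class≤ adm₂ u tt
  δ-constant (suc k₁) (suc k₂) {G₁} {G₂ = G₂} adm₁ adm₂ φ =
    Lift.constant adm₁ adm₂ φ
      (δ-constant k₁ k₂ (admissibleᶻ G₁ adm₁) (admissibleᶻ G₂ adm₂) (isoᶻ adm₁ adm₂ φ))

  -- From arbitrary equality to stable equality

  Stabilized : Group c ℓ → Group c (ℓ ⊔ a)
  Stabilized G = record
    { Carrier = Carrier
    ; _≈_ = λ x y → ~ ~ (x ≈ y)
    ; _∙_ = _∙_
    ; ε = ε
    ; _⁻¹ = _⁻¹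
    ; isGroup = record
      { isMonoid = record
        { isSemigroup = record
          { isMagma = record
            { isEquivalence = record
              { refl = return refl
              ; sym = ~~-map sym
              ; trans = λ e f k → e λ x≈y → f λ y≈z → k (trans x≈y y≈z)
              }
            ; ∙-cong = λ e f k → e λ x≈y → f λ u≈v → k (∙-cong x≈y u≈v)
            }
          ; assoc = λ x y z → return (assoc x y z)
          }
        ; identity = (λ x → return (identityˡ x)) , (λ x → return (identityʳ x))
        }
      ; inverse = (λ x → return (inverseˡ x)) , (λ x → return (inverseʳ x))
      ; ⁻¹-cong = ~~-map ⁻¹-cong
      }
    }
    where
    open Group G
    return : ∀ {q} {Q : Set q} → Q → ~ ~ Q
    return x k = k x

  module _ (G : Group c ℓ) where
    open Group G
    open GroupTheory G
    open GroupProperties G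

    ^≈↑ : ∀ x n → _^_ G x n ≈ x ↑ n
    ^≈↑ x zero    = refl
    ^≈↑ x (suc n) = ∙-congˡ (^≈↑ x n)

    leftNormed⇒γ : ∀ k {w} → LeftNormed (⁅_,_⁆ G) k w → γ G k w
    leftNormed⇒γ zero    _                 = tt
    leftNormed⇒γ (suc k) (u , y , uₖ , eq) = gen (u , y , leftNormed⇒γ k uₖ , reflexive eq)

    inv-word : ∀ {S} → Symmetric G S → ∀ {ts} → All (_∈ˡ S) ts →
               ∃[ us ] All (_∈ˡ S) us × ∏ ts ⁻¹ ≈ ∏ us
    inv-word S⁻¹ []            = [] , [] , ε⁻¹≈ε
    inv-word S⁻¹ (t∈S ∷ ts∈S) =
      let us , us∈S , e = inv-word S⁻¹ ts∈S
          u , u∈S , t⁻¹≈u = find (S⁻¹ (Any.map reflexive t∈S))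
      in us ++ [ u ] , All.++⁺ us∈S (u∈S ∷ []) ,
         trans (⁻¹-anti-homo-∙ _ _)
           (trans (∙-cong e (trans t⁻¹≈u (sym (identityʳ u)))) (sym (∏-++ us [ u ])))

    -- Symmetry of `S` allows words without inverse letters, the form in which walks in the graph
    -- are followed.
    word : ∀ {S} → Symmetric G S → ∀ {x} → ⟨_⟩ G (λ y → _∈S_ G y S) x →
           ∃[ ts ] All (_∈ˡ S) ts × x ≈ ∏ ts
    word S⁻¹ (gen x∈S) = let t , t∈S , x≈t = find x∈S in
      [ t ] , t∈S ∷ [] , trans x≈t (sym (identityʳ t))
    word S⁻¹ unit = [] , [] , refl
    word S⁻¹ (mul p q) =
      let ts , ts∈S , e = word S⁻¹ p
          us , us∈S , f = word S⁻¹ q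
      in ts ++ us , All.++⁺ ts∈S us∈S , trans (∙-cong e f) (sym (∏-++ ts us))
    word S⁻¹ (inv p) =
      let ts , ts∈S , e = word S⁻¹ p
          us , us∈S , f = inv-word S⁻¹ ts∈S
      in us , us∈S , trans (⁻¹-cong e) f
    word S⁻¹ (resp e p) =
      let ts , ts∈S , f = word S⁻¹ p in ts , ts∈S , trans (sym e) f

    admissible : TorsionFree G → (nil : Nilpotent G) → ∀ {S} → Symmetric G S →
                 Generates G S → Admissible (proj₁ nil) (Stabilized G) S
    admissible tf (k , nil) {S} S⁻¹ generates = record
      { stable      = λ e k → e λ e′ → e′ k
      ; torsionless = λ x n → ~~-map λ e → tf x n (trans (^≈↑ x (suc n)) e)
      ; class≤      = λ w wₖ k′ → k′ (nil w (leftNormed⇒γ k wₖ))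
      ; generated   = λ x → let ts , ts∈S , e = word S⁻¹ (generates x) in
                        ts , ts∈S , λ k′ → k′ e
      ; symmetric   = λ s∈S k′ →
                        k′ (Any.map (λ e k″ → k″ e) (S⁻¹ (Any.map reflexive s∈S)))
      }

  module _ {G₁ : Group c₁ ℓ₁} {G₂ : Group c₂ ℓ₂} {S₁ S₂} (φ : CayleyIso G₁ G₂ S₁ S₂) where
    private
      module G₁ = Group G₁
      module G₂ = Group G₂
    open CayleyIso φ
    open Bijection bij using (cong; injective; surjective)

    private
      from : G₂.Carrier → G₁.Carrier
      from y = proj₁ (surjective y)

      to-from : ∀ y → to (from y) G₂.≈ y
      to-from y = proj₂ (surjective y) G₁.refl

      label : ∀ (G : Group c ℓ) {S x y} → let open Group G in
              CayAdj G S x y → Any (λ l → ~ ~ (x ⁻¹ ∙ y ≈ l)) S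
      label G {x = x} {y} (s , s∈S , y≈xs) = Any.map
        (λ s≈l k → k (trans (trans (∙-congˡ y≈xs)
          (FreeGroupSolver.solve G 2 (λ x s → x ⁻ ⊙ (x ⊙ s) ⊜ s) refl x s)) s≈l)) s∈S
        where
        open Group G
        open FreeGroupSolver G using (_⊜_; _⊙_; _⁻)

      edge : ∀ (G : Group c ℓ) {S} x {s} → _∈_ (Stabilized G) s S →
             ~ ~ CayAdj G S x (Group._∙_ G x s)
      edge G x {s} s∈S k = s∈S λ i → let l , l∈S , s≈l = find i in
        s≈l λ e → k (l , Any.map reflexive l∈S , ∙-congˡ e)
        where open Group G

    stabilizedIso : GraphIso (Stabilized G₁) S₁ (Stabilized G₂) S₂
    stabilizedIso = record
      { to = to
      ; from = from
      ; to-cong = ~~-map cong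
      ; from-cong = ~~-map λ x≈y →
          injective (G₂.trans (to-from _) (G₂.trans x≈y (G₂.sym (to-from _))))
      ; to-from = λ y k → k (to-from y)
      ; from-to = λ x k → k (injective (to-from (to x)))
      ; to-∈ = λ x s∈S → ~~-map (λ e → label G₂ (preserve _ _ e)) (edge G₁ x s∈S)
      ; from-∈ = λ y s∈S → ~~-map
          (λ (l , l∈S , e) → label G₁ (reflect _ _ (l , l∈S , G₂.trans (to-from _)
            (G₂.trans e (G₂.∙-congʳ (G₂.sym (to-from _)))))))
          (edge G₂ y s∈S)
      }

theorem1p3 : ∀ {c₁ ℓ₁ c₂ ℓ₂ : Level}
    (G₁ : Group c₁ ℓ₁) (G₂ : Group c₂ ℓ₂)
    → TorsionFree G₁ → Nilpotent G₁
    → TorsionFree G₂ → Nilpotent G₂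
    → (S₁ : List (Group.Carrier G₁)) → Symmetric G₁ S₁ → Generates G₁ S₁
    → (S₂ : List (Group.Carrier G₂)) → Symmetric G₂ S₂ → Generates G₂ S₂
    → (φ : CayleyIso G₁ G₂ S₁ S₂)
    → AffineBijection G₁ G₂ (CayleyIso.to φ)
theorem1p3 G₁ G₂ tf₁ nil₁ tf₂ nil₂ S₁ sym₁ gen₁ S₂ sym₂ gen₂ φ =
  α , isIsomorphism , to G₁.ε ,
  λ x → solve 2 (λ p q → q ⊜ p ⊙ (p ⁻ ⊙ q)) refl (to G₁.ε) (to x)
  where
  module G₁ = Group G₁
  open CayleyIso φ using (to; bij)
  open Bijection bij using (cong; injective; surjective)
  open Group G₂
  open GroupProperties G₂
  open FreeGroupSolver G₂ using (solve; _⊜_; _⊙_; _⁻)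
  open SetoidReasoning setoid

  α : G₁.Carrier → Carrier
  α x = to G₁.ε ⁻¹ ∙ to x

  α-homo : ∀ x y → α (x G₁.∙ y) ≈ α x ∙ α y
  -- `A` is the goal itself, so the doubly negated equation between the increments from `x` and from
  -- `G₁.ε` proves the goal once that equation is shown to imply it.
  α-homo x y = δ-constant (proj₁ nil₁) (proj₁ nil₂)
      (admissible G₁ tf₁ nil₁ sym₁ gen₁) (admissible G₂ tf₂ nil₂ sym₂ gen₂)
      (stabilizedIso φ) x G₁.ε y
      λ e → begin
        α (x G₁.∙ y)
          ≈⟨ solve 3 (λ p q r → p ⁻ ⊙ r ⊜ p ⁻ ⊙ q ⊙ (q ⁻ ⊙ r)) refl (to G₁.ε) (to x) _ ⟩
        α x ∙ (to x ⁻¹ ∙ to (x G₁.∙ y))         ≈⟨ ∙-congˡ e ⟩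
        α x ∙ (to G₁.ε ⁻¹ ∙ to (G₁.ε G₁.∙ y))   ≈⟨ ∙-congˡ (∙-congˡ (cong (G₁.identityˡ y))) ⟩
        α x ∙ α y                               ∎
    where open Relative (α (x G₁.∙ y) ≈ α x ∙ α y)

  α-cong : ∀ {x y} → x G₁.≈ y → α x ≈ α y
  α-cong x≈y = ∙-congˡ (cong x≈y)

  isIsomorphism : GroupMorphisms.IsGroupIsomorphism G₁.rawGroup rawGroup α
  isIsomorphism = record
    { isGroupMonomorphism = record
      { isGroupHomomorphism = record
        { isMonoidHomomorphism = record
          { isMagmaHomomorphism = record
            { isRelHomomorphism = record { cong = α-cong } ; homo = α-homo }
          ; ε-homo = inverseˡ _
          }
        ; ⁻¹-homo = λ x → inverseˡ-unique _ _
            (trans (sym (α-homo _ _)) (trans (α-cong (G₁.inverseˡ x)) (inverseˡ _)))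
        }
      ; injective = λ e → injective (∙-cancelˡ (to G₁.ε ⁻¹) _ _ e)
      }
    ; surjective = λ y → let x , to≈ = surjective (to G₁.ε ∙ y) in
        x , λ e → trans (∙-congˡ (to≈ e))
          (solve 2 (λ p y → p ⁻ ⊙ (p ⊙ y) ⊜ y) refl (to G₁.ε) y)
    }
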